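{- Let $\alpha$ be a countable ordinal and let $\mathbb Z\cdot\alpha$ denote the linear order consisting of $\alpha$ consecutive copies of $\mathbb Z$ (i.e. $\alpha\times\mathbb Z$ ordered so that $(j,x)<(j',x')$ iff $j<j'$, or $j=j'$ and $x<x'$). (1) If $\alpha=m$ is finite (with $m\ge 1$), then $\mathsf{rk}(\mathbb Z\cdot m)=\omega+\lfloor\log_2(m+1)\rfloor$. (2) If $\alpha\ge\omega$ and the leading term of the Cantor normal form of $\alpha$ is $\omega^{\beta_1}\cdot c_1$ (so $\beta_1\ge1$, $1\le c_1<\omega$), then $\mathsf{rk}(\mathbb Z\cdot\alpha)=\omega\cdot(1+\beta_1)+\lfloor\log_2 c_1\rfloor$, where $1+\beta_1$ denotes ordinal addition with $1$ on the left.
   Context: Let $\mathcal F$ be the class of finite linear orders (language $\{<\}$). For a countable linear order $Y$, $\mathsf{age}(Y)$ is its set of finite suborders. If $A\le B$ and $|B\setminus A|=1$, $B$ is a prime extension of $A$. If $A\le B$, $A\le Y$, a realization of $B$ in $Y$ is some $C\le Y$ with $A\le C$ and an order isomorphism $B\to C$ fixing $A$ pointwise. For $F\in\mathsf{age}(Y)$: $\mathsf{rk}_Y(F)\ge 0$ always; $\mathsf{rk}_Y(F)\ge\alpha+1$ iff every prime extension $B$ of $F$ that is a finite linear order has a realization $C$ in $Y$ with $\mathsf{rk}_Y(C)\ge\alpha$; for limit $\alpha$, $\mathsf{rk}_Y(F)\ge\alpha$ iff $\mathsf{rk}_Y(F)\ge\beta$ for all $\beta<\alpha$; $\mathsf{rk}_Y(F)=\sup\{\alpha:\mathsf{rk}_Y(F)\ge\alpha\}$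 (value $\infty$ if unbounded); $\mathsf{rk}(Y)=\mathsf{rk}_Y(\emptyset)$. -}

module Defs where

open import Data.Nat as ℕ using (ℕ)
open import Data.Integer as ℤ using (ℤ)
open import Data.Fin using (Fin)
open import Data.List using (List; []; length; insertAt)
open import Data.List.Relation.Unary.Linked using (Linked)
open import Data.Product using (Σ; _×_; ∃; _,_)
open import Data.Sum using (_⊎_)
open import Data.Unit using (⊤)
open import Data.Empty using (⊥)
open import Relation.Nullary using (¬_)
open import Relation.Binary.PropositionalEquality using (_≡_)

data Ord : Set where
  zero : Ord
  suc  : Ord → Ord
  lim  : (ℕ → Ord) → Ord

mutual
  _≤ₒ_ : Ord → Ord → Set
  zero  ≤ₒ y = ⊤
  suc x ≤ₒ y = x <ₒ y
  lim f ≤ₒ y = ∀ n → f n ≤ₒ y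

  _<ₒ_ : Ord → Ord → Set
  x <ₒ zero  = ⊥
  x <ₒ suc y = x ≤ₒ y
  x <ₒ lim f = ∃ λ n → x <ₒ f n

infix 4 _≤ₒ_ _<ₒ_ _≈ₒ_

_≈ₒ_ : Ord → Ord → Set
x ≈ₒ y = x ≤ₒ y × y ≤ₒ x

fromℕ : ℕ → Ord
fromℕ ℕ.zero    = zero
fromℕ (ℕ.suc n) = suc (fromℕ n)

one : Ord
one = suc zero

ω : Ord
ω = lim fromℕ

infixl 6 _+ₒ_
infixl 7 _·ₒ_

_+ₒ_ : Ord → Ord → Ord
a +ₒ zero  = a
a +ₒ suc b = suc (a +ₒ b)
a +ₒ lim f = lim (λ n → a +ₒ f n)

_·ₒ_ : Ord → Ord → Ord
a ·ₒ zero  = zero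
a ·ₒ suc b = a ·ₒ b +ₒ a
a ·ₒ lim f = lim (λ n → a ·ₒ f n)

ω^ : Ord → Ord
ω^ zero    = one
ω^ (suc b) = ω^ b ·ₒ ω
ω^ (lim f) = lim (λ n → ω^ (f n))

ZTimes : Ord → Set
ZTimes α = Σ Ord (λ j → j <ₒ α) × ℤ

ZTimes-< : (α : Ord) → ZTimes α → ZTimes α → Set
ZTimes-< α ((j , _) , x) ((j' , _) , x') =
  (j <ₒ j') ⊎ ((j ≈ₒ j') × x ℤ.< x')

-- Rank of finite suborders of a linear order (Y , _<_).
-- A finite suborder F is a strictly increasing list of points.
-- A prime extension B of F (a finite linear order) is, up to isomorphism
-- over F, determined by the cut i : Fin (1 + |F|) where the new point sits;
-- a realization of B in Y is a point y with  insertAt F i y  strictly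
-- increasing, and C is that list.

module Rank {Y : Set} (_<_ : Y → Y → Set) where

  rk≥ : Ord → List Y → Set
  rk≥ zero    F = ⊤
  rk≥ (suc a) F = (i : Fin (ℕ.suc (length F))) →
                  Σ Y λ y → Linked _<_ (insertAt F i y) × rk≥ a (insertAt F i y)
  rk≥ (lim f) F = ∀ n → rk≥ (f n) F

  RankIs : Ord → Set
  RankIs γ = rk≥ γ [] × ¬ rk≥ (suc γ) []

RankZTimesIs : Ord → Ord → Set
RankZTimesIs α γ = Rank.RankIs (ZTimes-< α) γ

{-# OPTIONS --safe #-}
module Submission where

-- A move in the game defining rk picks a gap of F and splits it, and the other
-- gaps do not interact with it, so the rank of F is the minimum of the ranks of
-- its gaps.  A gap inside one copy of ℤ with n points has rank ⌊log₂ (n+1)⌋.  An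
-- infinite gap containing γ full copies of ℤ has rank at least ω·(1+β) + k iff
-- ω^β·2^k ≤ 1 + γ: splitting the gap cuts 1 + γ into two summands, so each unit
-- of rank costs a factor 2 and ω units cost a factor ω.
-- If α ≥ ω then ω^β₁ ≥ 2, hence ω^β₁·c₁ absorbs the 1 on its left, and
-- ω^β₁·2^k ≤ 1 + α = ω^β₁·c₁ + δ means 2^k ≤ c₁.

open import Defs
open import Data.Nat as ℕ using (ℕ; _≤_; _+_; zero; suc; _∸_; _^_; z≤n; s≤s)
open import Data.Nat.Logarithm using (⌊log₂_⌋; ⌊log₂⌋-mono-≤; ⌊log₂[2^n]⌋≡n)
open import Data.Product using (_×_; Σ; _,_; proj₁; proj₂)
open import Data.Fin using (zero; suc)
open import Data.Integer as ℤ using (ℤ; -[1+_]; ∣_∣)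
import Data.Integer.Properties as ℤ
open import Data.List using (List; []; _∷_; insertAt)
open import Data.List.Relation.Unary.Linked using (Linked; []; [-]; _∷_)
open import Data.Nat.Induction using (Acc; acc; <-wellFounded)
open import Data.Nat.Logarithm.Core using (⌊log2⌋)
import Data.Nat.Properties as ℕ
open import Data.Sum using (_⊎_; inj₁; inj₂)
open import Data.Unit using (⊤; tt)
open import Function using (id; _∘_)
open import Relation.Binary.Bundles using (Preorder)
open import Relation.Binary.PropositionalEquality
  using (_≡_; refl; sym; trans; cong; subst; subst₂; isEquivalence)
open import Relation.Nullary using (¬_; contradiction)
open import Relation.Nullary.Construct.Add.Infimum using (_₋; ⊥₋; [_])
open import Relation.Nullary.Construct.Add.Supremum using (_⁺; ⊤⁺)

-- Powers of two

2^suc : ∀ k → 2 ^ suc k ≡ 2 ^ k + 2 ^ k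
2^suc k = cong (2 ^ k +_) (ℕ.+-identityʳ (2 ^ k))

0<2^ : ∀ k → 1 ≤ 2 ^ k
0<2^ = ℕ.m^n>0 2

n<2^n : ∀ n → suc n ≤ 2 ^ n
n<2^n zero    = s≤s z≤n
n<2^n (suc n) rewrite 2^suc n = ℕ.+-mono-≤ (0<2^ n) (n<2^n n)

2^⌊log₂n⌋≤n : ∀ n → 1 ≤ n → 2 ^ ⌊log₂ n ⌋ ≤ n
2^⌊log₂n⌋≤n n = go n (<-wellFounded n)
  where
  -- `⌊log2⌋` recurses on its accessibility proof, so the induction has to allow an arbitrary one,
  -- and the recursive call is at `h`, the floor of n/2.
  go : ∀ n (rs : Acc _ n) → 1 ≤ n → 2 ^ ⌊log2⌋ n rs ≤ n
  go (suc zero)        _        _ = s≤s z≤n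
  go n@(suc (suc n-2)) (acc rs) _ = 2^[1+k]≤n
    where
    open ℕ.≤-Reasoning
    h = suc ℕ.⌊ n-2 /2⌋
    k = ⌊log2⌋ h (rs (ℕ.⌊n/2⌋<n (suc n-2)))
    2^[1+k]≤n : 2 ^ suc k ≤ n
    2^[1+k]≤n = begin
      2 ^ suc k          ≡⟨ 2^suc k ⟩
      2 ^ k + 2 ^ k      ≤⟨ ℕ.+-mono-≤ ih ih ⟩
      h + h              ≤⟨ ℕ.+-monoʳ-≤ h (ℕ.⌊n/2⌋≤⌈n/2⌉ n) ⟩
      h + ℕ.⌈ n /2⌉      ≡⟨ ℕ.⌊n/2⌋+⌈n/2⌉≡n n ⟩
      n                  ∎
      where
      ih = go h (rs (ℕ.⌊n/2⌋<n (suc n-2))) (s≤s z≤n)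

n<2^[1+⌊log₂n⌋] : ∀ n → suc n ≤ 2 ^ suc ⌊log₂ n ⌋
n<2^[1+⌊log₂n⌋] n = ℕ.≰⇒> λ p →
  ℕ.<-irrefl refl (ℕ.≤-trans (ℕ.≤-reflexive (sym (⌊log₂[2^n]⌋≡n (suc ⌊log₂ n ⌋)))) (⌊log₂⌋-mono-≤ p))

-- Order and arithmetic of Brouwer ordinals

-- The ordinal arguments are explicit because _≤ₒ_ computes, so that they
-- cannot be recovered from the type of a proof.

≤-lim : ∀ x f n → x ≤ₒ f n → x ≤ₒ lim f
≤-lim zero    f n p = tt
≤-lim (suc x) f n p = n , p
≤-lim (lim g) f n p = λ m → ≤-lim (g m) f n (p m)

mutual
  m≤n⇒m≤suc : ∀ x y → x ≤ₒ y → x ≤ₒ suc y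
  m≤n⇒m≤suc zero    y p = tt
  m≤n⇒m≤suc (suc x) y p = <⇒≤ x y p
  m≤n⇒m≤suc (lim f) y p = λ n → m≤n⇒m≤suc (f n) y (p n)

  <⇒≤ : ∀ x y → x <ₒ y → x ≤ₒ y
  <⇒≤ x (suc y) p       = m≤n⇒m≤suc x y p
  <⇒≤ x (lim f) (n , p) = ≤-lim x f n (<⇒≤ x (f n) p)

≤-refl : ∀ x → x ≤ₒ x
≤-refl zero    = tt
≤-refl (suc x) = ≤-refl x
≤-refl (lim f) = λ n → ≤-lim (f n) f n (≤-refl (f n))

mutual
  ≤-trans : ∀ x y z → x ≤ₒ y → y ≤ₒ z → x ≤ₒ z
  ≤-trans zero    y z p q = tt
  ≤-trans (suc x) y z p q = <-≤-trans x y z p q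
  ≤-trans (lim f) y z p q = λ n → ≤-trans (f n) y z (p n) q

  <-≤-trans : ∀ x y z → x <ₒ y → y ≤ₒ z → x <ₒ z
  <-≤-trans x (suc y) z p       q = ≤-<-trans x y z p q
  <-≤-trans x (lim f) z (n , p) q = <-≤-trans x (f n) z p (q n)

  ≤-<-trans : ∀ x y z → x ≤ₒ y → y <ₒ z → x <ₒ z
  ≤-<-trans x y (suc z) p q       = ≤-trans x y z p q
  ≤-<-trans x y (lim f) p (n , q) = n , ≤-<-trans x y (f n) p q

<-irrefl : ∀ x → ¬ x <ₒ x
<-irrefl (suc x) p       = <-irrefl x p
<-irrefl (lim f) (n , p) =
  <-irrefl (f n) (≤-<-trans (f n) (lim f) (f n) (≤-lim (f n) f n (≤-refl (f n))) p)

≤-reflexive : ∀ {x y} → x ≡ y → x ≤ₒ y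
≤-reflexive {x} refl = ≤-refl x

≤-preorder : Preorder _ _ _
≤-preorder = record
  { Carrier    = Ord
  ; _≈_        = _≡_
  ; _≲_        = _≤ₒ_
  ; isPreorder = record
    { isEquivalence = isEquivalence
    ; reflexive     = ≤-reflexive
    ; trans         = λ {x} {y} {z} → ≤-trans x y z
    }
  }

open import Relation.Binary.Reasoning.Preorder ≤-preorder

m≤m+n : ∀ a x → a ≤ₒ a +ₒ x
m≤m+n a zero    = ≤-refl a
m≤m+n a (suc x) = m≤n⇒m≤suc a (a +ₒ x) (m≤m+n a x)
m≤m+n a (lim f) = ≤-lim a (λ n → a +ₒ f n) 0 (m≤m+n a (f 0))

mutual
  +-monoʳ-≤ : ∀ a x y → x ≤ₒ y → a +ₒ x ≤ₒ a +ₒ y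
  +-monoʳ-≤ a zero    y p = m≤m+n a y
  +-monoʳ-≤ a (suc x) y p = +-monoʳ-< a x y p
  +-monoʳ-≤ a (lim f) y p = λ n → +-monoʳ-≤ a (f n) y (p n)

  +-monoʳ-< : ∀ a x y → x <ₒ y → a +ₒ x <ₒ a +ₒ y
  +-monoʳ-< a x (suc y) p       = +-monoʳ-≤ a x y p
  +-monoʳ-< a x (lim f) (n , p) = n , +-monoʳ-< a x (f n) p

+-monoˡ-≤ : ∀ a x y → x ≤ₒ y → x +ₒ a ≤ₒ y +ₒ a
+-monoˡ-≤ zero    x y p = p
+-monoˡ-≤ (suc a) x y p = +-monoˡ-≤ a x y p
+-monoˡ-≤ (lim f) x y p = λ n →
  ≤-lim (x +ₒ f n) (λ m → y +ₒ f m) n (+-monoˡ-≤ (f n) x y p)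

mutual
  +-cancelˡ-≤ : ∀ a x y → a +ₒ x ≤ₒ a +ₒ y → x ≤ₒ y
  +-cancelˡ-≤ a zero    y p = tt
  +-cancelˡ-≤ a (suc x) y p = +-cancelˡ-< a x y p
  +-cancelˡ-≤ a (lim f) y p = λ n → +-cancelˡ-≤ a (f n) y (p n)

  +-cancelˡ-< : ∀ a x y → a +ₒ x <ₒ a +ₒ y → x <ₒ y
  +-cancelˡ-< a x zero    p       =
    <-irrefl a (≤-<-trans a (a +ₒ x) a (m≤m+n a x) p)
  +-cancelˡ-< a x (suc y) p       = +-cancelˡ-≤ a x y p
  +-cancelˡ-< a x (lim f) (n , p) = n , +-cancelˡ-< a x (f n) p

+-assoc-≤ : ∀ a b c → a +ₒ b +ₒ c ≤ₒ a +ₒ (b +ₒ c)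
+-assoc-≤ a b zero    = ≤-refl (a +ₒ b)
+-assoc-≤ a b (suc c) = +-assoc-≤ a b c
+-assoc-≤ a b (lim f) = λ n →
  ≤-lim (a +ₒ b +ₒ f n) (λ m → a +ₒ (b +ₒ f m)) n (+-assoc-≤ a b (f n))

+-assoc-≥ : ∀ a b c → a +ₒ (b +ₒ c) ≤ₒ a +ₒ b +ₒ c
+-assoc-≥ a b zero    = ≤-refl (a +ₒ b)
+-assoc-≥ a b (suc c) = +-assoc-≥ a b c
+-assoc-≥ a b (lim f) = λ n →
  ≤-lim (a +ₒ (b +ₒ f n)) (λ m → a +ₒ b +ₒ f m) n (+-assoc-≥ a b (f n))

+-identityˡ-≤ : ∀ x → zero +ₒ x ≤ₒ x
+-identityˡ-≤ zero    = tt
+-identityˡ-≤ (suc x) = +-identityˡ-≤ x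
+-identityˡ-≤ (lim f) = λ n → ≤-lim (zero +ₒ f n) f n (+-identityˡ-≤ (f n))

+-identityˡ-≥ : ∀ x → x ≤ₒ zero +ₒ x
+-identityˡ-≥ zero    = tt
+-identityˡ-≥ (suc x) = +-identityˡ-≥ x
+-identityˡ-≥ (lim f) = λ n →
  ≤-lim (f n) (λ m → zero +ₒ f m) n (+-identityˡ-≥ (f n))

+-identityˡ-fromℕ : ∀ n → zero +ₒ fromℕ n ≡ fromℕ n
+-identityˡ-fromℕ zero    = refl
+-identityˡ-fromℕ (suc n) = cong suc (+-identityˡ-fromℕ n)

one+fromℕ : ∀ n → one +ₒ fromℕ n ≡ fromℕ (suc n)
one+fromℕ zero    = refl
one+fromℕ (suc n) = cong suc (one+fromℕ n)

one·fromℕ : ∀ n → one ·ₒ fromℕ n ≡ fromℕ n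
one·fromℕ zero    = refl
one·fromℕ (suc n) = cong suc (one·fromℕ n)

fromℕ-mono-≤ : ∀ {m n} → m ≤ n → fromℕ m ≤ₒ fromℕ n
fromℕ-mono-≤ z≤n     = tt
fromℕ-mono-≤ (s≤s p) = fromℕ-mono-≤ p

fromℕ-cancel-≤ : ∀ m n → fromℕ m ≤ₒ fromℕ n → m ≤ n
fromℕ-cancel-≤ zero    n       p = z≤n
fromℕ-cancel-≤ (suc m) (suc n) p = s≤s (fromℕ-cancel-≤ m n p)

·-monoʳ-fromℕ : ∀ a {m n} → m ≤ n → a ·ₒ fromℕ m ≤ₒ a ·ₒ fromℕ n
·-monoʳ-fromℕ a z≤n                     = tt
·-monoʳ-fromℕ a (s≤s {m = m} {n = n} p) =
  +-monoˡ-≤ a (a ·ₒ fromℕ m) (a ·ₒ fromℕ n) (·-monoʳ-fromℕ a p)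

·-distribˡ-≤ : ∀ a m n → a ·ₒ fromℕ (m + n) ≤ₒ a ·ₒ fromℕ m +ₒ a ·ₒ fromℕ n
·-distribˡ-≤ a m zero    rewrite ℕ.+-identityʳ m = ≤-refl (a ·ₒ fromℕ m)
·-distribˡ-≤ a m (suc n) rewrite ℕ.+-suc m n = begin
  a ·ₒ fromℕ (m + n) +ₒ a
    ≲⟨ +-monoˡ-≤ a (a ·ₒ fromℕ (m + n)) (a ·ₒ fromℕ m +ₒ a ·ₒ fromℕ n) (·-distribˡ-≤ a m n) ⟩
  a ·ₒ fromℕ m +ₒ a ·ₒ fromℕ n +ₒ a
    ≲⟨ +-assoc-≤ (a ·ₒ fromℕ m) (a ·ₒ fromℕ n) a ⟩
  a ·ₒ fromℕ m +ₒ (a ·ₒ fromℕ n +ₒ a) ∎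

·-distribˡ-≥ : ∀ a m n → a ·ₒ fromℕ m +ₒ a ·ₒ fromℕ n ≤ₒ a ·ₒ fromℕ (m + n)
·-distribˡ-≥ a m zero    rewrite ℕ.+-identityʳ m = ≤-refl (a ·ₒ fromℕ m)
·-distribˡ-≥ a m (suc n) rewrite ℕ.+-suc m n = begin
  a ·ₒ fromℕ m +ₒ (a ·ₒ fromℕ n +ₒ a)
    ≲⟨ +-assoc-≥ (a ·ₒ fromℕ m) (a ·ₒ fromℕ n) a ⟩
  a ·ₒ fromℕ m +ₒ a ·ₒ fromℕ n +ₒ a
    ≲⟨ +-monoˡ-≤ a (a ·ₒ fromℕ m +ₒ a ·ₒ fromℕ n) (a ·ₒ fromℕ (m + n)) (·-distribˡ-≥ a m n) ⟩
  a ·ₒ fromℕ (m + n) +ₒ a ∎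

0<ω^ : ∀ β → zero <ₒ ω^ β
0<ω^ zero    = tt
0<ω^ (suc β) = 1 , <-≤-trans zero (ω^ β) (zero +ₒ ω^ β) (0<ω^ β) (+-identityˡ-≥ (ω^ β))
0<ω^ (lim f) = 0 , 0<ω^ (f 0)

-- The positivity of an exponent is not decidable for limits; requiring the
-- upper bound z to exceed 1 avoids deciding it.
one+ω^≤ : ∀ β z → fromℕ 2 ≤ₒ z → ω^ β ≤ₒ z → one +ₒ ω^ β ≤ₒ z
one+ω^≤ zero    z 2≤z p = 2≤z
one+ω^≤ (lim f) z 2≤z p = λ n → one+ω^≤ (f n) z 2≤z (p n)
one+ω^≤ (suc β) z 2≤z p = λ n → begin
  one +ₒ A ·ₒ fromℕ n            ≲⟨ +-monoˡ-≤ (A ·ₒ fromℕ n) one (A ·ₒ fromℕ 1) one≤A ⟩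
  A ·ₒ fromℕ 1 +ₒ A ·ₒ fromℕ n   ≲⟨ ·-distribˡ-≥ A 1 n ⟩
  A ·ₒ fromℕ (suc n)             ≲⟨ p (suc n) ⟩
  z                              ∎
  where
  A = ω^ β
  one≤A : one ≤ₒ A ·ₒ fromℕ 1
  one≤A = ≤-trans one A (zero +ₒ A) (0<ω^ β) (+-identityˡ-≥ A)

one+ω^·≤ : ∀ β c → fromℕ 2 ≤ₒ ω^ β → 1 ≤ c → one +ₒ ω^ β ·ₒ fromℕ c ≤ₒ ω^ β ·ₒ fromℕ c
one+ω^·≤ β (suc zero) 2≤A _ = begin
  one +ₒ (zero +ₒ A)  ≲⟨ +-monoʳ-≤ one (zero +ₒ A) A (+-identityˡ-≤ A) ⟩
  one +ₒ A            ≲⟨ one+ω^≤ β A 2≤A (≤-refl A) ⟩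
  A                   ≲⟨ +-identityˡ-≥ A ⟩
  zero +ₒ A           ∎
  where A = ω^ β
one+ω^·≤ β (suc c@(suc _)) 2≤A _ = begin
  one +ₒ (A ·ₒ fromℕ c +ₒ A)  ≲⟨ +-assoc-≥ one (A ·ₒ fromℕ c) A ⟩
  one +ₒ A ·ₒ fromℕ c +ₒ A    ≲⟨ +-monoˡ-≤ A (one +ₒ A ·ₒ fromℕ c) (A ·ₒ fromℕ c)
                                     (one+ω^·≤ β c 2≤A (s≤s z≤n)) ⟩
  A ·ₒ fromℕ c +ₒ A           ∎
  where A = ω^ β

-- A constructive pigeonhole: each successor in `y` uses up one unit of `l`, and at a limit a
-- positive lower bound names the branch to descend into.
fromℕ≤+⇒ : ∀ l k x y → fromℕ (l + k) ≤ₒ x +ₒ y → fromℕ k ≤ₒ x ⊎ fromℕ (suc l) ≤ₒ y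
fromℕ≤+⇒ l k x zero p =
  inj₁ (≤-trans (fromℕ k) (fromℕ (l + k)) x (fromℕ-mono-≤ (ℕ.m≤n+m k l)) p)
fromℕ≤+⇒ zero    k       x (suc y) p = inj₂ tt
fromℕ≤+⇒ (suc l) k       x (suc y) p = fromℕ≤+⇒ l k x y p
fromℕ≤+⇒ zero    zero    x (lim f) p = inj₁ tt
fromℕ≤+⇒ zero    (suc k) x (lim f) (n , p) with fromℕ≤+⇒ zero (suc k) x (f n) p
... | inj₁ q = inj₁ q
... | inj₂ q = inj₂ (n , q)
fromℕ≤+⇒ (suc l) k       x (lim f) (n , p) with fromℕ≤+⇒ (suc l) k x (f n) p
... | inj₁ q = inj₁ q
... | inj₂ q = inj₂ (n , q)

-- Either the last copy of `a` is already at least 2, or dropping it leaves the same situation with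
-- one copy fewer; with no copies left it is absurd.
suc≤·⇒2≤ : ∀ a c → fromℕ (suc c) ≤ₒ a ·ₒ fromℕ c → fromℕ 2 ≤ₒ a
suc≤·⇒2≤ a (suc c) p with fromℕ≤+⇒ 1 (suc c) (a ·ₒ fromℕ c) a p
... | inj₁ q = suc≤·⇒2≤ a c q
... | inj₂ q = q

-- Extracts what is needed of β ≥ 1 from α ≥ ω. Comparing with `suc c` alone suffices: either the
-- copies of `ω^ β` exceed their number, or 1 ≤ δ < `ω^ β`.
ω≤⇒2≤ω^ : ∀ β δ c → δ <ₒ ω^ β → ω ≤ₒ ω^ β ·ₒ fromℕ c +ₒ δ → fromℕ 2 ≤ₒ ω^ β
ω≤⇒2≤ω^ β δ c δ<A ω≤ with fromℕ≤+⇒ 0 (suc c) (ω^ β ·ₒ fromℕ c) δ (ω≤ (suc c))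
... | inj₁ q = suc≤·⇒2≤ (ω^ β) c q
... | inj₂ q = ≤-<-trans one δ (ω^ β) q δ<A

-- The rank of a finite suborder, gap by gap

module Gaps {Y : Set} (_<_ : Y → Y → Set) (<-trans : ∀ x y z → x < y → y < z → x < z) where

  open Rank _<_

  -- The adjoined ends make the outermost gaps of a list pairs of bounds like all the others.
  Before : Y ₋ → Y ⁺ → Set
  Before ⊥₋    b     = ⊤
  Before [ x ] ⊤⁺    = ⊤
  Before [ x ] [ y ] = x < y

  Before-trans : ∀ a {y} b → Before a [ y ] → Before [ y ] b → Before a b
  Before-trans ⊥₋    b     p q = tt
  Before-trans [ x ] ⊤⁺    p q = tt
  Before-trans [ x ] {y} [ z ] p q = <-trans x y z p q

  Splits : (Y ₋ → Y ⁺ → Set) → Y ₋ → Y ⁺ → Set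
  Splits Q a b = Σ Y λ y → Q a [ y ] × Q [ y ] b

  -- The rank game confined to one gap. Level `zero` asks for `Before`, so that a bound on all gaps
  -- also makes the list increasing.
  gap≥ : Ord → Y ₋ → Y ⁺ → Set
  gap≥ zero    a b = Before a b
  gap≥ (suc γ) a b = Splits (gap≥ γ) a b
  gap≥ (lim f) a b = ∀ n → gap≥ (f n) a b

  -- A move in another gap lowers the level by one without touching this gap. The same splitting
  -- point serves, with both halves weakened.
  gap≥-suc⇒gap≥ : ∀ γ {a b} → gap≥ (suc γ) a b → gap≥ γ a b
  gap≥-suc⇒gap≥ zero    {a} {b} (y , p , q) = Before-trans a b p q
  gap≥-suc⇒gap≥ (suc γ) (y , p , q) = y , gap≥-suc⇒gap≥ γ p , gap≥-suc⇒gap≥ γ q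
  gap≥-suc⇒gap≥ (lim f) (y , p , q) = λ n → gap≥-suc⇒gap≥ (f n) (y , p n , q n)

  AllGaps : (Y ₋ → Y ⁺ → Set) → Y ₋ → List Y → Set
  AllGaps P a []      = P a ⊤⁺
  AllGaps P a (y ∷ F) = P a [ y ] × AllGaps P [ y ] F

  AllGaps-map : ∀ {P Q} → (∀ {a b} → P a b → Q a b) → ∀ {a} F → AllGaps P a F → AllGaps Q a F
  AllGaps-map f []      p       = f p
  AllGaps-map f (y ∷ F) (p , r) = f p , AllGaps-map f F r

  AllGaps-Π : ∀ {P : ℕ → Y ₋ → Y ⁺ → Set} {a} F →
    (∀ n → AllGaps (P n) a F) → AllGaps (λ a b → ∀ n → P n a b) a F
  AllGaps-Π []      h = h
  AllGaps-Π (y ∷ F) h = (λ n → proj₁ (h n)) , AllGaps-Π F (λ n → proj₂ (h n))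

  -- The answer to a move at one cut splits only that gap, so each gap takes its split from its own
  -- cut and the rest of that answer is discarded.
  AllGaps-merge : ∀ {Q a} F → (∀ i → Σ Y λ y → AllGaps Q a (insertAt F i y)) →
    AllGaps (Splits Q) a F
  AllGaps-merge []      h = h zero
  AllGaps-merge (x ∷ F) h with h zero
  ... | y , p , q , _ = (y , p , q) , AllGaps-merge F λ i → let (z , _ , r) = h (suc i) in z , r

  -- `s` answers in the gap that was played; `w` brings all other gaps down to the same level.
  AllGaps-split : ∀ {P Q} → (∀ {a b} → P a b → Splits Q a b) → (∀ {a b} → P a b → Q a b) →
    ∀ {a} F → AllGaps P a F → ∀ i → Σ Y λ y → AllGaps Q a (insertAt F i y)
  AllGaps-split s w []      p       zero    = s p
  AllGaps-split s w (x ∷ F) (p , r) zero    =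
    let (y , p₁ , p₂) = s p in y , p₁ , p₂ , AllGaps-map w F r
  AllGaps-split s w (x ∷ F) (p , r) (suc i) =
    let (y , r′) = AllGaps-split s w F r i in y , w p , r′

  Linked⇒AllGaps : ∀ F → Linked _<_ F → AllGaps Before ⊥₋ F
  Linked⇒AllGaps []      l = tt
  Linked⇒AllGaps (x ∷ F) l = tt , go l
    where
    go : ∀ {x F} → Linked _<_ (x ∷ F) → AllGaps Before [ x ] F
    go [-]     = tt
    go (p ∷ l) = p , go l

  AllGaps⇒Linked : ∀ F → AllGaps Before ⊥₋ F → Linked _<_ F
  AllGaps⇒Linked []      _       = []
  AllGaps⇒Linked (x ∷ F) (_ , r) = go F r
    where
    go : ∀ {x} F → AllGaps Before [ x ] F → Linked _<_ (x ∷ F)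
    go []      _       = [-]
    go (y ∷ F) (p , r) = p ∷ go F r

  -- Together with `AllGaps⇒rk≥` this makes the rank of `F` the minimum of its gap ranks. `Linked`
  -- enters because `rk≥ zero` carries no order information.
  rk≥⇒AllGaps : ∀ γ F → Linked _<_ F → rk≥ γ F → AllGaps (gap≥ γ) ⊥₋ F
  rk≥⇒AllGaps zero    F l _ = Linked⇒AllGaps F l
  rk≥⇒AllGaps (suc γ) F l h = AllGaps-merge F λ i →
    let (y , l′ , r) = h i in y , rk≥⇒AllGaps γ (insertAt F i y) l′ r
  rk≥⇒AllGaps (lim f) F l h = AllGaps-Π F λ n → rk≥⇒AllGaps (f n) F l (h n)

  gap≥⇒Before : ∀ γ {a b} → gap≥ γ a b → Before a b
  gap≥⇒Before zero    p = p
  gap≥⇒Before (suc γ) p = gap≥⇒Before γ (gap≥-suc⇒gap≥ γ p)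
  gap≥⇒Before (lim f) p = gap≥⇒Before (f 0) (p 0)

  AllGaps⇒rk≥ : ∀ γ F → AllGaps (gap≥ γ) ⊥₋ F → rk≥ γ F
  AllGaps⇒rk≥ zero    F g   = tt
  AllGaps⇒rk≥ (suc γ) F g i =
    let (y , r) = AllGaps-split id (gap≥-suc⇒gap≥ γ) F g i
        F′      = insertAt F i y
    in  y , AllGaps⇒Linked F′ (AllGaps-map (gap≥⇒Before γ) F′ r) , AllGaps⇒rk≥ γ F′ r
  AllGaps⇒rk≥ (lim f) F g n = AllGaps⇒rk≥ (f n) F (AllGaps-map (λ p → p n) F g)

  RankIs-gap≥ : ∀ γ → gap≥ γ ⊥₋ ⊤⁺ → ¬ gap≥ (suc γ) ⊥₋ ⊤⁺ → RankIs γ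
  RankIs-gap≥ γ p ¬p = AllGaps⇒rk≥ γ [] p , ¬p ∘ rk≥⇒AllGaps (suc γ) [] []

  module _ (P : ℕ → Y ₋ → Y ⁺ → Set) (γ : Ord) where

    -- `P n` stands for rank at least γ + n: splitting `P (suc n)` into two `P n` answers one move.
    -- `gap≥⇒ladder` is the dual, gluing two halves together.
    ladder⇒gap≥ : (∀ {a b} → P 0 a b → gap≥ γ a b) →
      (∀ n {a b} → P (suc n) a b → Splits (P n) a b) →
      ∀ n {a b} → P n a b → gap≥ (γ +ₒ fromℕ n) a b
    ladder⇒gap≥ base step zero    p = base p
    ladder⇒gap≥ base step (suc n) p =
      let (y , p₁ , p₂) = step n p
      in  y , ladder⇒gap≥ base step n p₁ , ladder⇒gap≥ base step n p₂

    gap≥⇒ladder : (∀ {a b} → gap≥ γ a b → P 0 a b) →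
      (∀ n {a b} → Splits (P n) a b → P (suc n) a b) →
      ∀ n {a b} → gap≥ (γ +ₒ fromℕ n) a b → P n a b
    gap≥⇒ladder base step zero    g            = base g
    gap≥⇒ladder base step (suc n) (y , g₁ , g₂) =
      step n (y , gap≥⇒ladder base step n g₁ , gap≥⇒ladder base step n g₂)

ZTimes-<-trans : ∀ α x y z → ZTimes-< α x y → ZTimes-< α y z → ZTimes-< α x z
ZTimes-<-trans α ((i , _) , _) ((j , _) , _) ((k , _) , _) (inj₁ p) (inj₁ q) =
  inj₁ (≤-<-trans i j k (<⇒≤ i j p) q)
ZTimes-<-trans α ((i , _) , _) ((j , _) , _) ((k , _) , _) (inj₁ p) (inj₂ ((q , _) , _)) =
  inj₁ (<-≤-trans i j k p q)
ZTimes-<-trans α ((i , _) , _) ((j , _) , _) ((k , _) , _) (inj₂ ((p , _) , _)) (inj₁ q) =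
  inj₁ (≤-<-trans i j k p q)
ZTimes-<-trans α ((i , _) , _) ((j , _) , _) ((k , _) , _)
  (inj₂ ((p , p′) , x<y)) (inj₂ ((q , q′) , y<z)) =
  inj₂ ((≤-trans i j k p q , ≤-trans k j i q′ p′) , ℤ.<-trans x<y y<z)

-- The gaps of ℤ·α

module GapsOfZTimes (α : Ord) (0<α : zero <ₒ α) where

  open Gaps (ZTimes-< α) (ZTimes-<-trans α)

  private
    Y = ZTimes α

  -- The arithmetic form of rank at least `n` for finite `n`: two points of one copy at distance d
  -- enclose d - 1 points, and a move halves d. Infinite gaps are unrestricted.
  Apart : ℕ → Y ₋ → Y ⁺ → Set
  Apart n ⊥₋    b  = ⊤
  Apart n [ _ ] ⊤⁺ = ⊤
  Apart n [ (i , _) , x ] [ (j , _) , y ] =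
    (i <ₒ j) ⊎ ((i ≈ₒ j) × x ℤ.+ ℤ.+ (2 ^ n) ℤ.≤ y)

  Apart⇒Before : ∀ a b → Apart 0 a b → Before a b
  Apart⇒Before ⊥₋    b     p = tt
  Apart⇒Before [ _ ] ⊤⁺    p = tt
  Apart⇒Before [ _ ] [ _ ] (inj₁ p) = inj₁ p
  Apart⇒Before [ _ , x ] [ _ ] (inj₂ (p , q)) =
    inj₂ (p , ℤ.suc[i]≤j⇒i<j (subst (ℤ._≤ _) (ℤ.+-comm x ℤ.1ℤ) q))

  Before⇒Apart : ∀ a b → Before a b → Apart 0 a b
  Before⇒Apart ⊥₋    b     p = tt
  Before⇒Apart [ _ ] ⊤⁺    p = tt
  Before⇒Apart [ _ ] [ _ ] (inj₁ p) = inj₁ p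
  Before⇒Apart [ _ , x ] [ _ ] (inj₂ (p , q)) =
    inj₂ (p , subst (ℤ._≤ _) (ℤ.+-comm ℤ.1ℤ x) (ℤ.i<j⇒suc[i]≤j q))

  +2^suc : ∀ x n → x ℤ.+ ℤ.+ (2 ^ suc n) ≡ x ℤ.+ ℤ.+ (2 ^ n) ℤ.+ ℤ.+ (2 ^ n)
  +2^suc x n = trans (cong (λ k → x ℤ.+ ℤ.+ k) (2^suc n))
                     (sym (ℤ.+-assoc x (ℤ.+ (2 ^ n)) (ℤ.+ (2 ^ n))))

  -- The new point goes exactly 2^n away from a finite end, the left one if there is one; that half
  -- is tight and the other keeps the remainder. With no finite end any point will do.
  Apart-split : ∀ n a b → Apart (suc n) a b → Splits (Apart n) a b
  Apart-split n ⊥₋ ⊤⁺ p = ((zero , 0<α) , ℤ.0ℤ) , tt , tt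
  Apart-split n ⊥₋ [ (j , j<α) , y ] p =
    ((j , j<α) , y ℤ.- k) , tt , inj₂ ((≤-refl j , ≤-refl j) , ℤ.≤-reflexive y-k+k≡y)
    where
    k = ℤ.+ (2 ^ n)
    y-k+k≡y : y ℤ.- k ℤ.+ k ≡ y
    y-k+k≡y = trans (ℤ.+-assoc y (ℤ.- k) k)
                    (trans (cong (ℤ._+_ y) (ℤ.+-inverseˡ k)) (ℤ.+-identityʳ y))
  Apart-split n [ (i , i<α) , x ] ⊤⁺ p =
    ((i , i<α) , x ℤ.+ ℤ.+ (2 ^ n)) , inj₂ ((≤-refl i , ≤-refl i) , ℤ.≤-refl) , tt
  Apart-split n [ (i , i<α) , x ] [ (j , j<α) , y ] p =
    ((i , i<α) , x ℤ.+ ℤ.+ (2 ^ n)) , inj₂ ((≤-refl i , ≤-refl i) , ℤ.≤-refl) , right p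
    where
    right : Apart (suc n) [ (i , i<α) , x ] [ (j , j<α) , y ] →
            Apart n [ (i , i<α) , x ℤ.+ ℤ.+ (2 ^ n) ] [ (j , j<α) , y ]
    right (inj₁ i<j)       = inj₁ i<j
    right (inj₂ (i≈j , q)) = inj₂ (i≈j , subst (ℤ._≤ y) (+2^suc x n) q)

  Apart-merge : ∀ n a b → Splits (Apart n) a b → Apart (suc n) a b
  Apart-merge n ⊥₋    b  _ = tt
  Apart-merge n [ _ ] ⊤⁺ _ = tt
  Apart-merge n [ (i , _) , x ] [ (k , _) , z ] (((j , _) , y) , inj₁ p , inj₁ q) =
    inj₁ (≤-<-trans i j k (<⇒≤ i j p) q)
  Apart-merge n [ (i , _) , x ] [ (k , _) , z ] (((j , _) , y) , inj₁ p , inj₂ ((q , _) , _)) =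
    inj₁ (<-≤-trans i j k p q)
  Apart-merge n [ (i , _) , x ] [ (k , _) , z ] (((j , _) , y) , inj₂ ((p , _) , _) , inj₁ q) =
    inj₁ (≤-<-trans i j k p q)
  Apart-merge n [ (i , _) , x ] [ (k , _) , z ]
    (((j , _) , y) , inj₂ ((p , p′) , r) , inj₂ ((q , q′) , s)) =
    inj₂ ((≤-trans i j k p q , ≤-trans k j i q′ p′) ,
          subst (ℤ._≤ z) (sym (+2^suc x n)) (ℤ.≤-trans (ℤ.+-monoˡ-≤ (ℤ.+ (2 ^ n)) r) s))

  Apart⇒gap≥ω : ∀ {a b} → (∀ n → Apart n a b) → gap≥ ω a b
  Apart⇒gap≥ω {a} {b} h n = subst (λ γ → gap≥ γ a b) (+-identityˡ-fromℕ n)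
    (ladder⇒gap≥ Apart zero (λ {a} {b} → Apart⇒Before a b) (λ n {a} {b} → Apart-split n a b) n (h n))

  gap≥ω⇒Apart : ∀ {a b} → gap≥ ω a b → ∀ n → Apart n a b
  gap≥ω⇒Apart {a} {b} g n =
    gap≥⇒ladder Apart zero (λ {a} {b} → Before⇒Apart a b) (λ n {a} {b} → Apart-merge n a b) n
      (subst (λ γ → gap≥ γ a b) (sym (+-identityˡ-fromℕ n)) (g n))

  -- `ω ·ₒ one` unfolds to the limit of `zero +ₒ fromℕ n`, which matches `ω` only through a
  -- propositional equality at each n.
  gap≥ω⇒gap≥ω·one : ∀ {a b} → gap≥ ω a b → gap≥ (ω ·ₒ one) a b
  gap≥ω⇒gap≥ω·one {a} {b} g n = subst (λ γ → gap≥ γ a b) (sym (+-identityˡ-fromℕ n)) (g n)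

  gap≥ω·one⇒gap≥ω : ∀ {a b} → gap≥ (ω ·ₒ one) a b → gap≥ ω a b
  gap≥ω·one⇒gap≥ω {a} {b} g n = subst (λ γ → gap≥ γ a b) (+-identityˡ-fromℕ n) (g n)

  -- Copies cannot be compared decidably, but the hypothesis at n = |y - x| decides: staying in one
  -- copy would force 2^n ≤ n.
  ∀Apart⇒< : ∀ {i j : Σ Ord (_<ₒ α)} {x y} →
    (∀ n → Apart n [ i , x ] [ j , y ]) → proj₁ i <ₒ proj₁ j
  ∀Apart⇒< {i} {j} {x} {y} h with h ∣ ℤ.- x ℤ.+ y ∣
  ... | inj₁ p       = p
  ... | inj₂ (_ , p) = contradiction 2^d≤d (ℕ.<⇒≱ (n<2^n d))
    where
    d = ∣ ℤ.- x ℤ.+ y ∣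
    k = ℤ.+ (2 ^ d)
    i≤+∣i∣ : ∀ z → z ℤ.≤ ℤ.+ ∣ z ∣
    i≤+∣i∣ (ℤ.+ n)  = ℤ.≤-refl
    i≤+∣i∣ -[1+ n ] = ℤ.-≤+
    -x+[x+k]≡k : ℤ.- x ℤ.+ (x ℤ.+ k) ≡ k
    -x+[x+k]≡k = trans (sym (ℤ.+-assoc (ℤ.- x) x k))
                       (trans (cong (ℤ._+ k) (ℤ.+-inverseˡ x)) (ℤ.+-identityˡ k))
    2^d≤d : 2 ^ d ≤ d
    2^d≤d = ℤ.drop‿+≤+ (ℤ.≤-trans (subst (ℤ._≤ ℤ.- x ℤ.+ y) -x+[x+k]≡k (ℤ.+-monoʳ-≤ (ℤ.- x) p))
                                  (i≤+∣i∣ (ℤ.- x ℤ.+ y)))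

  -- Counting copies in an infinite gap

  val : Y ⁺ → Ord
  val ⊤⁺              = α
  val [ (j , _) , _ ] = j

  val≤α : ∀ b → val b ≤ₒ α
  val≤α ⊤⁺                = ≤-refl α
  val≤α [ (j , j<α) , _ ] = <⇒≤ j α j<α

  -- Copy j sits at position 1 + j, the left end at 0 and the right end at 1 + α.

  pos : Y ₋ → Ord
  pos ⊥₋              = zero
  pos [ (i , _) , _ ] = one +ₒ i

  -- The necessary condition for rank `ω·(1+β) + k`: a lower bound on the distance between
  -- positions, written additively in place of an ordinal subtraction.
  Far : Ord → ℕ → Y ₋ → Y ⁺ → Set
  Far β k a b = pos a +ₒ ω^ β ·ₒ fromℕ (2 ^ k) ≤ₒ one +ₒ val b

  -- The splitting point ends one half and starts the other at the same position `one +ₒ j`, so the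
  -- two distances chain and 2^k doubles.
  Far-merge : ∀ β k {a b} → Splits (Far β k) a b → Far β (suc k) a b
  Far-merge β k {a} {b} (((j , _) , _) , p , q) = begin
    pos a +ₒ ω^ β ·ₒ fromℕ (2 ^ suc k)
      ≡⟨ cong (λ n → pos a +ₒ ω^ β ·ₒ fromℕ n) (2^suc k) ⟩
    pos a +ₒ ω^ β ·ₒ fromℕ (2 ^ k + 2 ^ k)
      ≲⟨ +-monoʳ-≤ (pos a) (ω^ β ·ₒ fromℕ (2 ^ k + 2 ^ k)) (A +ₒ A)
           (·-distribˡ-≤ (ω^ β) (2 ^ k) (2 ^ k)) ⟩
    pos a +ₒ (A +ₒ A)   ≲⟨ +-assoc-≥ (pos a) A A ⟩
    pos a +ₒ A +ₒ A     ≲⟨ +-monoˡ-≤ A (pos a +ₒ A) (one +ₒ j) p ⟩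
    one +ₒ j +ₒ A       ≲⟨ q ⟩
    one +ₒ val b        ∎
    where A = ω^ β ·ₒ fromℕ (2 ^ k)

  gap≥ω⇒Far : ∀ {a b} → gap≥ ω a b → Far zero 0 a b
  gap≥ω⇒Far {a} {b} g = go a b (gap≥ω⇒Apart g)
    where
    -- `Far zero 0` unfolds to this strict inequality, since `ω^ zero ·ₒ fromℕ 1` reduces to `one`.
    go : ∀ a b → (∀ n → Apart n a b) → pos a <ₒ one +ₒ val b
    go ⊥₋ b h = m≤m+n one (val b)
    go [ (i , i<α) , _ ] ⊤⁺ h = +-monoʳ-< one i α i<α
    go [ i , x ] [ j , y ] h =
      +-monoʳ-< one (proj₁ i) (proj₁ j) (∀Apart⇒< {i} {j} {x} {y} h)

  -- At a successor, ω further levels give distance `ω^β·2^n` for every n; as 2^n ≥ n, these bounds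
  -- reach the supremum `ω^(β+1)`.
  gap≥⇒Far : ∀ β {a b} → gap≥ (ω ·ₒ (one +ₒ β)) a b → Far β 0 a b
  gap≥⇒Far zero    g = gap≥ω⇒Far (gap≥ω·one⇒gap≥ω g)
  gap≥⇒Far (lim f) g = λ n → gap≥⇒Far (f n) (g n)
  gap≥⇒Far (suc β) {a} {b} g = λ n → begin
    pos a +ₒ (zero +ₒ ω^ β ·ₒ fromℕ n)
      ≲⟨ +-monoʳ-≤ (pos a) (zero +ₒ ω^ β ·ₒ fromℕ n) (ω^ β ·ₒ fromℕ n)
           (+-identityˡ-≤ (ω^ β ·ₒ fromℕ n)) ⟩
    pos a +ₒ ω^ β ·ₒ fromℕ n
      ≲⟨ +-monoʳ-≤ (pos a) (ω^ β ·ₒ fromℕ n) (ω^ β ·ₒ fromℕ (2 ^ n))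
           (·-monoʳ-fromℕ (ω^ β) (ℕ.<⇒≤ (n<2^n n))) ⟩
    pos a +ₒ ω^ β ·ₒ fromℕ (2 ^ n)
      ≲⟨ gap≥⇒ladder (Far β) (ω ·ₒ (one +ₒ β)) (gap≥⇒Far β) (Far-merge β) n (g n) ⟩
    one +ₒ val b ∎

  -- The ordinal val b must reach for the gap (a , b) to have rank at least
  -- ω·(1+β) + k.  For a = -∞, where 1 + val b ≥ ω^β·2^k is the sharp condition,
  -- e = 1 gives it when β = 0; e = 0 gives a sufficient one for every β, without
  -- deciding whether β is zero.

  reach : ℕ → Ord → ℕ → Y ₋ → Ord
  reach e β k ⊥₋              = ω^ β ·ₒ fromℕ (2 ^ k ∸ e)
  reach e β k [ (i , _) , _ ] = i +ₒ ω^ β ·ₒ fromℕ (2 ^ k)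

  Roomy : ℕ → Ord → ℕ → Y ₋ → Y ⁺ → Set
  Roomy e β k a b = reach e β k a ≤ₒ val b

  -- The bound on `e` keeps the truncated subtraction exact: (2^k - e) + 2^k = 2^(k+1) - e needs e ≤
  -- 2^k.
  reach-double : ∀ e β k a → e ≤ 1 →
    reach e β k a +ₒ ω^ β ·ₒ fromℕ (2 ^ k) ≤ₒ reach e β (suc k) a
  reach-double e β k ⊥₋ e≤1 = begin
    ω^ β ·ₒ fromℕ (2 ^ k ∸ e) +ₒ ω^ β ·ₒ fromℕ (2 ^ k)
      ≲⟨ ·-distribˡ-≥ (ω^ β) (2 ^ k ∸ e) (2 ^ k) ⟩
    ω^ β ·ₒ fromℕ ((2 ^ k ∸ e) + 2 ^ k)
      ≡⟨ cong (λ n → ω^ β ·ₒ fromℕ n)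
           (trans (sym (ℕ.+-∸-comm (2 ^ k) (ℕ.≤-trans e≤1 (0<2^ k)))) (cong (_∸ e) (sym (2^suc k)))) ⟩
    ω^ β ·ₒ fromℕ (2 ^ suc k ∸ e) ∎
  reach-double e β k [ (i , _) , _ ] e≤1 = begin
    i +ₒ A +ₒ A     ≲⟨ +-assoc-≤ i A A ⟩
    i +ₒ (A +ₒ A)   ≲⟨ +-monoʳ-≤ i (A +ₒ A) (ω^ β ·ₒ fromℕ (2 ^ k + 2 ^ k))
                         (·-distribˡ-≥ (ω^ β) (2 ^ k) (2 ^ k)) ⟩
    i +ₒ ω^ β ·ₒ fromℕ (2 ^ k + 2 ^ k)
      ≡⟨ cong (λ n → i +ₒ ω^ β ·ₒ fromℕ n) (sym (2^suc k)) ⟩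
    i +ₒ ω^ β ·ₒ fromℕ (2 ^ suc k) ∎
    where A = ω^ β ·ₒ fromℕ (2 ^ k)

  Roomy-split : ∀ e β → e ≤ 1 → ∀ k {a b} → Roomy e β (suc k) a b → Splits (Roomy e β k) a b
  -- The new point sits in the copy indexed by the reach of level `k` itself: the left half is
  -- tight, and the right half keeps `A`.
  Roomy-split e β e≤1 k {a} {b} p = ((r , r<α) , ℤ.0ℤ) , ≤-refl r , r+A≤b
    where
    r = reach e β k a
    A = ω^ β ·ₒ fromℕ (2 ^ k)
    r+A≤b : r +ₒ A ≤ₒ val b
    r+A≤b = ≤-trans (r +ₒ A) (reach e β (suc k) a) (val b) (reach-double e β k a e≤1) p
    0<A : zero <ₒ A
    0<A = <-≤-trans zero (ω^ β) A (0<ω^ β)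
            (≤-trans (ω^ β) (ω^ β ·ₒ fromℕ 1) A (+-identityˡ-≥ (ω^ β)) (·-monoʳ-fromℕ (ω^ β) (0<2^ k)))
    r<α : r <ₒ α
    r<α = <-≤-trans r (r +ₒ A) α (+-monoʳ-< r zero A 0<A)
            (≤-trans (r +ₒ A) (val b) α r+A≤b (val≤α b))

  reach-mono : ∀ β k β′ k′ a → ω^ β ·ₒ fromℕ (2 ^ k) ≤ₒ ω^ β′ ·ₒ fromℕ (2 ^ k′) →
    reach 0 β k a ≤ₒ reach 0 β′ k′ a
  reach-mono β k β′ k′ ⊥₋              p = p
  reach-mono β k β′ k′ [ (i , _) , _ ] p =
    +-monoʳ-≤ i (ω^ β ·ₒ fromℕ (2 ^ k)) (ω^ β′ ·ₒ fromℕ (2 ^ k′)) p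

  -- A gap with an infinite end is infinite; between two points `reach` unfolds to the successor of
  -- the left copy, so they lie in different copies.
  Roomy⇒gap≥ω : ∀ e {a b} → Roomy e zero 0 a b → gap≥ ω a b
  Roomy⇒gap≥ω e {a} {b} p = Apart⇒gap≥ω (λ n → go a b p n)
    where
    go : ∀ a b → Roomy e zero 0 a b → ∀ n → Apart n a b
    go ⊥₋    b     p n = tt
    go [ _ ] ⊤⁺    p n = tt
    go [ _ ] [ _ ] p n = inj₁ p

  Roomy⇒gap≥ : ∀ β {a b} → Roomy 0 β 0 a b → gap≥ (ω ·ₒ (one +ₒ β)) a b
  Roomy⇒gap≥ zero    p = gap≥ω⇒gap≥ω·one (Roomy⇒gap≥ω 0 p)
  Roomy⇒gap≥ (lim f) {a} {b} p = λ n → Roomy⇒gap≥ (f n)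
    (≤-trans (reach 0 (f n) 0 a) (reach 0 (lim f) 0 a) (val b)
      (reach-mono (f n) 0 (lim f) 0 a
        (≤-lim (zero +ₒ ω^ (f n)) (λ m → zero +ₒ ω^ (f m)) n (≤-refl (zero +ₒ ω^ (f n)))))
      p)
  Roomy⇒gap≥ (suc β) {a} {b} p = λ n →
    ladder⇒gap≥ (Roomy 0 β) (ω ·ₒ (one +ₒ β)) (Roomy⇒gap≥ β) (Roomy-split 0 β z≤n) n
      (≤-trans (reach 0 β n a) (reach 0 (suc β) 0 a) (val b)
        (reach-mono β n (suc β) 0 a
          -- `ω^β·2^n` is, up to `zero +ₒ`, the term of index 2^n in the sequence defining
          -- `ω^(β+1)`.
          (≤-lim (A n) (λ m → zero +ₒ ω^ β ·ₒ fromℕ m) (2 ^ n) (+-identityˡ-≥ (A n))))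
        p)
    where
    A : ℕ → Ord
    A n = ω^ β ·ₒ fromℕ (2 ^ n)

-- The two rank formulas

rank-finite : ∀ m → 1 ≤ m → RankZTimesIs (fromℕ m) (ω +ₒ fromℕ ⌊log₂ (m + 1) ⌋)
rank-finite m 1≤m = RankIs-gap≥ (ω +ₒ fromℕ k) lower upper
  where
  open Gaps (ZTimes-< (fromℕ m)) (ZTimes-<-trans (fromℕ m))
  open GapsOfZTimes (fromℕ m) (fromℕ-mono-≤ 1≤m)
  k = ⌊log₂ (m + 1) ⌋
  2^k∸1≤m : 2 ^ k ∸ 1 ≤ m
  2^k∸1≤m = ℕ.≤-trans (ℕ.∸-monoˡ-≤ 1 (2^⌊log₂n⌋≤n (m + 1) (ℕ.m≤n+m 1 m)))
                      (ℕ.≤-reflexive (ℕ.m+n∸n≡m m 1))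
  lower : gap≥ (ω +ₒ fromℕ k) ⊥₋ ⊤⁺
  -- Here e = 1 is essential: 2^k ≤ m + 1 provides only 2^k - 1 copies.
  lower = ladder⇒gap≥ (Roomy 1 zero) ω (Roomy⇒gap≥ω 1) (Roomy-split 1 zero (s≤s z≤n)) k
    (subst (_≤ₒ fromℕ m) (sym (one·fromℕ (2 ^ k ∸ 1))) (fromℕ-mono-≤ 2^k∸1≤m))
  upper : ¬ gap≥ (ω +ₒ fromℕ (suc k)) ⊥₋ ⊤⁺
  upper g = ℕ.<⇒≱ (n<2^[1+⌊log₂n⌋] (m + 1))
    (subst (2 ^ suc k ≤_) (ℕ.+-comm 1 m) (fromℕ-cancel-≤ (2 ^ suc k) (suc m)
      (subst₂ _≤ₒ_ zero+one·2^≡ (one+fromℕ m)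
        (gap≥⇒ladder (Far zero) ω gap≥ω⇒Far (Far-merge zero) (suc k) g))))
    where
    zero+one·2^≡ : zero +ₒ one ·ₒ fromℕ (2 ^ suc k) ≡ fromℕ (2 ^ suc k)
    zero+one·2^≡ = trans (cong (zero +ₒ_) (one·fromℕ (2 ^ suc k))) (+-identityˡ-fromℕ (2 ^ suc k))

rank-infinite : ∀ α β δ c → ω ≤ₒ α → 1 ≤ c → δ <ₒ ω^ β → α ≈ₒ ω^ β ·ₒ fromℕ c +ₒ δ →
  RankZTimesIs α (ω ·ₒ (one +ₒ β) +ₒ fromℕ ⌊log₂ c ⌋)
rank-infinite α β δ c ω≤α 1≤c δ<A (α≤ , α≥) =
  RankIs-gap≥ (ω ·ₒ (one +ₒ β) +ₒ fromℕ k) lower upper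
  where
  open Gaps (ZTimes-< α) (ZTimes-<-trans α)
  -- `fromℕ 1 ≤ₒ α` is definitionally the required `zero <ₒ α`.
  open GapsOfZTimes α (ω≤α 1)
  k  = ⌊log₂ c ⌋
  A  = ω^ β
  Ac = A ·ₒ fromℕ c
  lower : gap≥ (ω ·ₒ (one +ₒ β) +ₒ fromℕ k) ⊥₋ ⊤⁺
  lower = ladder⇒gap≥ (Roomy 0 β) (ω ·ₒ (one +ₒ β)) (Roomy⇒gap≥ β) (Roomy-split 0 β z≤n) k (begin
    A ·ₒ fromℕ (2 ^ k)  ≲⟨ ·-monoʳ-fromℕ A (2^⌊log₂n⌋≤n c 1≤c) ⟩
    Ac                  ≲⟨ m≤m+n Ac δ ⟩
    Ac +ₒ δ             ≲⟨ α≥ ⟩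
    α                   ∎)
  2≤A : fromℕ 2 ≤ₒ A
  2≤A = ω≤⇒2≤ω^ β δ c δ<A (≤-trans ω α (Ac +ₒ δ) ω≤α α≤)
  upper : ¬ gap≥ (ω ·ₒ (one +ₒ β) +ₒ fromℕ (suc k)) ⊥₋ ⊤⁺
  -- One level more would give `A·(c+1)` ≤ 1 + α ≤ `Ac + δ`, the 1 being absorbed by `Ac`.
  -- Cancelling `Ac` leaves A ≤ δ, against δ < A.
  upper g = <-irrefl δ (<-≤-trans δ A δ δ<A (+-cancelˡ-≤ Ac A δ (begin
    A ·ₒ fromℕ (suc c)
      ≲⟨ ·-monoʳ-fromℕ A (n<2^[1+⌊log₂n⌋] c) ⟩
    A ·ₒ fromℕ (2 ^ suc k)
      ≲⟨ +-identityˡ-≥ (A ·ₒ fromℕ (2 ^ suc k)) ⟩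
    zero +ₒ A ·ₒ fromℕ (2 ^ suc k)
      ≲⟨ gap≥⇒ladder (Far β) (ω ·ₒ (one +ₒ β)) (gap≥⇒Far β) (Far-merge β) (suc k) g ⟩
    one +ₒ α             ≲⟨ +-monoʳ-≤ one α (Ac +ₒ δ) α≤ ⟩
    one +ₒ (Ac +ₒ δ)     ≲⟨ +-assoc-≥ one Ac δ ⟩
    one +ₒ Ac +ₒ δ       ≲⟨ +-monoˡ-≤ δ (one +ₒ Ac) Ac (one+ω^·≤ β c 2≤A 1≤c) ⟩
    Ac +ₒ δ              ∎)))

theorem6p20 : ((m : ℕ) → 1 ≤ m →
    RankZTimesIs (fromℕ m) (ω +ₒ fromℕ ⌊log₂ (m + 1) ⌋))
    ×
    ((α β₁ δ : Ord) (c₁ : ℕ) → ω ≤ₒ α → 1 ≤ c₁ →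
    δ <ₒ ω^ β₁ → α ≈ₒ ω^ β₁ ·ₒ fromℕ c₁ +ₒ δ →
    RankZTimesIs α (ω ·ₒ (one +ₒ β₁) +ₒ fromℕ ⌊log₂ c₁ ⌋))
theorem6p20 = rank-finite , rank-infinite
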